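{- Let $p,k,q,n$ be positive integers. If there exist an S-template with width $q$ and $n+1$ colors and an S-template with width $p$ and $k$ colors, then there exists an S-template with width $pq$ and $n+k$ colors.
   Context: A set $A \subseteq \mathbb{N}$ is sum-free if for all $(a,b)\in A^2$ (allowing $a=b$), $a+b \notin A$. For positive integers $p,n$, an S-template with $n$ colors and width $p$ is a partition of $\{1,\dots,p\}$ into $n$ sum-free subsets $A_1,\dots,A_n$ such that for every $i \in \{1,\dots,n-1\}$ (i.e. every subset except $A_n$) and all $(x,y)\in A_i^2$: if $x+y>p$ then $x+y-p \notin A_i$. -}

module Defs where

open import Data.Fin using (Fin; toℕ)
open import Data.Nat using (ℕ; suc; _+_; _∸_; _≤_; _<_)
open import Data.Product using (_×_)
open import Level using (0ℓ)
open import Relation.Binary.PropositionalEquality using (_≢_)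
open import Relation.Unary using (Pred; _∈_; _∉_; _≐_; _⊥_; ⋃)

SumFree : Pred ℕ 0ℓ → Set
SumFree A = ∀ a b → a ∈ A → b ∈ A → a + b ∉ A

⟦1…_⟧ : ℕ → Pred ℕ 0ℓ
⟦1… p ⟧ x = 1 ≤ x × x ≤ p

-- As usual for colorings, a class may be empty: a color need not be used.
record IsPartition (X : Pred ℕ 0ℓ) {n : ℕ} (A : Fin n → Pred ℕ 0ℓ) : Set where
  field
    union    : ⋃ (Fin n) A ≐ X
    disjoint : ∀ i j → i ≢ j → A i ⊥ A j

-- The class A_i (1 ≤ i ≤ n) is A j with i = suc (toℕ j), so the condition
-- suc (toℕ j) < n leaves out exactly the last class A_n.  In `modular`,
-- p < x + y makes the truncated subtraction exact.
record IsSTemplate (p n : ℕ) (A : Fin n → Pred ℕ 0ℓ) : Set where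
  field
    partition : IsPartition ⟦1… p ⟧ A
    sumFree   : ∀ i → SumFree (A i)
    modular   : ∀ j → suc (toℕ j) < n → ∀ x y → x ∈ A j → y ∈ A j →
                p < x + y → x + y ∸ p ∉ A j

{-# OPTIONS --safe #-}
module Submission where

-- Write x ∈ {1, …, pq} as x = r + d q with 1 ≤ r ≤ q and 0 ≤ d < p.  If the
-- A-color of r is not the last one, it becomes the color of x: the modular
-- condition on A makes such a class sum-free modulo q, so also modulo pq.
-- Otherwise x is colored by the B-color of d + 1: the last class of A being
-- sum-free, a sum staying in it produces a carry, and then the numbers d + 1
-- simply add up, so the conditions on B carry over.

open import Defs
open import Data.Fin using (Fin; zero; toℕ; splitAt; join; _↑ˡ_; _↑ʳ_)
open import Data.Fin.Properties
  using (_≟_; toℕ<n; toℕ-↑ˡ; toℕ-↑ʳ; ↑ˡ-injective; ↑ʳ-injective;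
         splitAt-↑ˡ; splitAt-↑ʳ; splitAt⁻¹-↑ʳ; join-splitAt)
open import Data.Nat
  using (ℕ; zero; suc; _+_; _*_; _∸_; _<_; _≤_; _≤?_; s≤s; z≤n; NonZero; >-nonZero)
open import Data.Nat.DivMod using (_/_; _%_; m≡m%n+[m/n]*n; m%n<n; m<n*o⇒m/o<n)
open import Data.Nat.Properties hiding (_≟_)
open import Data.Nat.Tactic.RingSolver using (solve-∀)
open import Data.Product using (_×_; _,_; proj₁; proj₂; ∃-syntax)
open import Data.Sum using (_⊎_; inj₁; inj₂)
open import Level using (0ℓ)
open import Relation.Binary.PropositionalEquality
open import Relation.Nullary using (yes; no; contradiction; decidable-stable)
open import Relation.Unary using (Pred; _∈_; _∉_; _⊆_)

Modular : ℕ → Pred ℕ 0ℓ → Set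
Modular p A = ∀ x y → x ∈ A → y ∈ A → p < x + y → x + y ∸ p ∉ A

-- Residues are taken in {1, …, q} and the d-th block, starting from d = 0,
-- carries the number suc d.
Blocks : ℕ → Pred ℕ 0ℓ → Pred ℕ 0ℓ → Pred ℕ 0ℓ
Blocks q S T x = ∃[ r ] ∃[ d ] (x ≡ r + d * q × r ∈ S × suc d ∈ T)

-- Induction on both block indices: block 0 stays at or below `q`, every later block lies above `q`,
-- and two later blocks can both be shifted down by `q`.
digits-unique : ∀ {q r s} d e → r ∈ ⟦1… q ⟧ → s ∈ ⟦1… q ⟧ →
                r + d * q ≡ s + e * q → r ≡ s × d ≡ e
digits-unique {q} {r} {s} zero zero _ _ eq =
  +-cancelʳ-≡ 0 r s eq , refl
digits-unique {q} {r} {s} zero (suc e) (_ , r≤q) (1≤s , _) eq =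
  contradiction (subst (_≤ q) (trans (sym (+-identityʳ r)) eq) r≤q)
    (<⇒≱ (+-mono-≤ 1≤s (m≤m+n q (e * q))))
digits-unique {q} {r} {s} (suc d) zero (1≤r , _) (_ , s≤q) eq =
  contradiction (subst (_≤ q) (trans (sym (+-identityʳ s)) (sym eq)) s≤q)
    (<⇒≱ (+-mono-≤ 1≤r (m≤m+n q (d * q))))
digits-unique {q} {r} {s} (suc d) (suc e) r∈ s∈ eq =
  let r≡s , d≡e = digits-unique d e r∈ s∈
        (+-cancelˡ-≡ q _ _ (trans (shift q r d) (trans eq (sym (shift q s e)))))
  in r≡s , cong suc d≡e
  where
  shift : ∀ q r d → q + (r + d * q) ≡ r + (q + d * q)
  shift = solve-∀

digits-+ : ∀ q r s d e → (r + s) + (d + e) * q ≡ (r + d * q) + (s + e * q)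
digits-+ = solve-∀

module _ {q : ℕ} {S : Pred ℕ 0ℓ} (S⊆ : S ⊆ ⟦1… q ⟧) (S-free : SumFree S) where

  -- Without a carry r + s would be the residue t, against sum-freeness of S.
  carry : ∀ {r s t} d e g → r ∈ S → s ∈ S → t ∈ S →
          (r + d * q) + (s + e * q) ≡ t + g * q →
          q < r + s × t ≡ r + s ∸ q × suc d + suc e ≡ suc g
  carry {r} {s} {t} d e g r∈ s∈ t∈ eq with r + s ≤? q
  ... | yes r+s≤q = contradiction (subst S (sym (proj₁ same)) t∈) (S-free r s r∈ s∈)
    where
    same = digits-unique (d + e) g
      (≤-trans (proj₁ (S⊆ r∈)) (m≤m+n r s) , r+s≤q) (S⊆ t∈)
      (trans (digits-+ q r s d e) eq)
  -- As `r` and `s` are at most `q`, the excess `v` is again a residue, now in block `suc (d + e)`.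
  -- The carried one makes the block numbers, which start at 1, add up exactly.
  ... | no r+s≰q =
      q<r+s , sym (proj₁ same) , cong suc (trans (+-suc d e) (proj₂ same))
    where
    q<r+s = ≰⇒> r+s≰q
    v = r + s ∸ q
    v≤q : v ≤ q
    v≤q = m≤n+o⇒m∸n≤o (r + s) q (+-mono-≤ (proj₂ (S⊆ r∈)) (proj₂ (S⊆ s∈)))
    borrow : ∀ q v d e → v + (q + (d + e) * q) ≡ (v + q) + (d + e) * q
    borrow = solve-∀
    same = digits-unique (suc (d + e)) g (m<n⇒0<n∸m q<r+s , v≤q) (S⊆ t∈)
      (trans (borrow q v d e)
        (trans (cong (_+ (d + e) * q) (m∸n+n≡m (<⇒≤ q<r+s)))
          (trans (digits-+ q r s d e) eq)))

  -- After the forced carry either factor gives the contradiction: the residues wrap around inside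
  -- `S`, and the block numbers add inside `T`.
  blocks-sumFree : ∀ {T} → Modular q S ⊎ SumFree T → SumFree (Blocks q S T)
  blocks-sumFree {T} h _ _ (r , d , refl , r∈ , d∈) (s , e , refl , s∈ , e∈) (t , g , eq , t∈ , g∈)
    with carry d e g r∈ s∈ t∈ eq | h
  ... | q<r+s , t≡ , _ | inj₁ S-mod  = S-mod r s r∈ s∈ q<r+s (subst S t≡ t∈)
  ... | _ , _ , g≡ | inj₂ T-free = T-free _ _ d∈ e∈ (subst T (sym g≡) g∈)

  blocks-modular : ∀ {p T} → Modular q S ⊎ Modular p T → Modular (p * q) (Blocks q S T)
  blocks-modular {p} {T} h x y (r , d , refl , r∈ , d∈) (s , e , refl , s∈ , e∈) pq<x+y
                 (t , f , eq , t∈ , f∈)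
    -- Adding `p * q` back to `x + y ∸ p * q` keeps the residue `t` and raises the block index from
    -- `f` to `f + p`.
    with carry d e (f + p) r∈ s∈ t∈
           (trans (sym (m∸n+n≡m (<⇒≤ pq<x+y)))
             (trans (cong (_+ p * q) eq)
               (trans (+-assoc t (f * q) (p * q))
                 (cong (t +_) (sym (*-distribʳ-+ q f p)))))) | h
  ... | q<r+s , t≡ , _ | inj₁ S-mod = S-mod r s r∈ s∈ q<r+s (subst S t≡ t∈)
  ... | _ , _ , g≡ | inj₂ T-mod =
    T-mod _ _ d∈ e∈
      -- The block numbers sum to `suc (f + p)`, which exceeds `p` and reduces to `suc f`.
      (subst (p <_) (sym g≡) (s≤s (m≤n+m p f)))
      (subst T (sym (trans (cong (_∸ p) g≡) (m+n∸n≡m (suc f) p))) f∈)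

blocks-⊆ : ∀ {p q S T} → S ⊆ ⟦1… q ⟧ → T ⊆ ⟦1… p ⟧ → Blocks q S T ⊆ ⟦1… p * q ⟧
blocks-⊆ {p} {q} S⊆ T⊆ (r , d , refl , r∈ , d∈) =
  ≤-trans (proj₁ (S⊆ r∈)) (m≤m+n r (d * q)) ,
  ≤-trans (+-monoˡ-≤ (d * q) (proj₂ (S⊆ r∈))) (*-monoˡ-≤ q (proj₂ (T⊆ d∈)))

digits-exist : ∀ {p q x} → .{{NonZero q}} → x ∈ ⟦1… p * q ⟧ →
               Blocks q ⟦1… q ⟧ ⟦1… p ⟧ x
-- Dividing the predecessor moves the remainders to {1, ..., q}, so that a multiple of `q` closes
-- its block instead of opening the next.
digits-exist {p} {q} {suc x} (_ , x<pq) =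
  suc (x % q) , x / q , cong suc (m≡m%n+[m/n]*n x q) ,
  (s≤s z≤n , m%n<n x q) , (s≤s z≤n , m<n*o⇒m/o<n x<pq)

module _ {X : Pred ℕ 0ℓ} {n : ℕ} {A : Fin n → Pred ℕ 0ℓ} (P : IsPartition X A) where
  open IsPartition P

  class-⊆ : ∀ i → A i ⊆ X
  class-⊆ i x∈ = proj₁ union (i , x∈)

  class-unique : ∀ {i j x} → x ∈ A i → x ∈ A j → i ≡ j
  class-unique {i} {j} x∈i x∈j =
    decidable-stable (i ≟ j) (λ i≢j → disjoint i j i≢j (x∈i , x∈j))

module Product {p q n k : ℕ} .{{_ : NonZero q}}
  {A : Fin (n + 1) → Pred ℕ 0ℓ} (tA : IsSTemplate q (n + 1) A)
  {B : Fin k → Pred ℕ 0ℓ} (tB : IsSTemplate p k B) where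

  private
    module A = IsSTemplate tA
    module B = IsSTemplate tB

  -- The right summand shares the last class of `A`, whose numbers are then told apart by their
  -- block numbers.
  residueColor : Fin n ⊎ Fin k → Fin (n + 1)
  residueColor (inj₁ i) = i ↑ˡ 1
  residueColor (inj₂ _) = n ↑ʳ zero

  -- Letting the left colors accept every block makes both kinds of class instances of `Blocks`.
  blockNumbers : Fin n ⊎ Fin k → Pred ℕ 0ℓ
  blockNumbers (inj₁ _) = ⟦1… p ⟧
  blockNumbers (inj₂ j) = B j

  color : Fin n ⊎ Fin k → Pred ℕ 0ℓ
  color c = Blocks q (A (residueColor c)) (blockNumbers c)

  -- Listing the colors of `A` first makes the last color of `B` the last one overall, hence the one
  -- exempt from the modular condition.
  C : Fin (n + k) → Pred ℕ 0ℓ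
  C c = color (splitAt n c)

  blockNumbers-⊆ : ∀ c → blockNumbers c ⊆ ⟦1… p ⟧
  blockNumbers-⊆ (inj₁ _) d∈ = d∈
  blockNumbers-⊆ (inj₂ j) = class-⊆ B.partition j

  residues-⊆ : ∀ c → A (residueColor c) ⊆ ⟦1… q ⟧
  residues-⊆ c = class-⊆ A.partition (residueColor c)

  color-⊆ : ∀ c → color c ⊆ ⟦1… p * q ⟧
  color-⊆ c = blocks-⊆ {T = blockNumbers c} (residues-⊆ c) (blockNumbers-⊆ c)

  color-exists : ∀ {x} → x ∈ ⟦1… p * q ⟧ → ∃[ c ] x ∈ color c
  color-exists x∈ with digits-exist {p} x∈
  ... | r , d , x≡ , r∈ , d∈ with proj₂ (IsPartition.union A.partition) r∈
  -- Matching the second component with `refl` rewrites `a` as `i ↑ˡ 1` or `n ↑ʳ zero`, the two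
  -- values of `residueColor`.
  ... | a , r∈a with splitAt n a | join-splitAt n 1 a
  ... | inj₁ i    | refl = inj₁ i , r , d , x≡ , r∈a , d∈
  ... | inj₂ zero | refl with proj₂ (IsPartition.union B.partition) d∈
  ... | j , d∈j = inj₂ j , r , d , x≡ , r∈a , d∈j

  lower≢last : ∀ (i : Fin n) → i ↑ˡ 1 ≢ n ↑ʳ zero
  lower≢last i eq
    with () ← trans (sym (splitAt-↑ˡ n i 1)) (trans (cong (splitAt n) eq) (splitAt-↑ʳ n 1 zero))

  color-determined : ∀ c c′ {r d} → r ∈ A (residueColor c) → r ∈ A (residueColor c′) →
                     suc d ∈ blockNumbers c → suc d ∈ blockNumbers c′ → c ≡ c′
  color-determined (inj₁ i) (inj₁ i′) r∈ r∈′ _ _ =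
    cong inj₁ (↑ˡ-injective 1 i i′ (class-unique A.partition r∈ r∈′))
  color-determined (inj₁ i) (inj₂ _) r∈ r∈′ _ _ =
    contradiction (class-unique A.partition r∈ r∈′) (lower≢last i)
  color-determined (inj₂ _) (inj₁ i) r∈ r∈′ _ _ =
    contradiction (class-unique A.partition r∈′ r∈) (lower≢last i)
  color-determined (inj₂ _) (inj₂ _) _ _ d∈ d∈′ =
    cong inj₂ (class-unique B.partition d∈ d∈′)

  color-unique : ∀ c c′ {x} → x ∈ color c → x ∈ color c′ → c ≡ c′
  color-unique c c′ (r , d , refl , r∈ , d∈) (s , e , eq , s∈ , e∈)
    with digits-unique d e (residues-⊆ c r∈) (residues-⊆ c′ s∈) eq
  ... | refl , refl = color-determined c c′ r∈ s∈ d∈ e∈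

  partition : IsPartition ⟦1… p * q ⟧ C
  partition = record
    { union    = (λ (c , x∈) → color-⊆ (splitAt n c) x∈) , covered
    ; disjoint = λ c c′ c≢c′ (x∈ , x∈′) → c≢c′
        (trans (sym (join-splitAt n k c))
          (trans (cong (join n k) (color-unique (splitAt n c) (splitAt n c′) x∈ x∈′))
            (join-splitAt n k c′)))
    }
    where
    covered : ∀ {x} → x ∈ ⟦1… p * q ⟧ → ∃[ c ] x ∈ C c
    covered {x} x∈ with color-exists x∈
    ... | inj₁ i , x∈c = i ↑ˡ k , subst (λ c → x ∈ color c) (sym (splitAt-↑ˡ n i k)) x∈c
    ... | inj₂ j , x∈c = n ↑ʳ j , subst (λ c → x ∈ color c) (sym (splitAt-↑ʳ n k j)) x∈c

  -- The embedding into `Fin (n + 1)` misses only the last color, the exempt one.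
  lower-modular : ∀ i → Modular q (A (i ↑ˡ 1))
  lower-modular i = A.modular (i ↑ˡ 1)
    (subst₂ _<_ (cong suc (sym (toℕ-↑ˡ i 1))) (+-comm 1 n) (s≤s (toℕ<n i)))

  color-sumFree : ∀ c → SumFree (color c)
  color-sumFree c = blocks-sumFree (residues-⊆ c) (A.sumFree (residueColor c)) (side c)
    where
    side : ∀ c → Modular q (A (residueColor c)) ⊎ SumFree (blockNumbers c)
    side (inj₁ i) = inj₁ (lower-modular i)
    side (inj₂ j) = inj₂ (B.sumFree j)

  C-modular : ∀ c → suc (toℕ c) < n + k → Modular (p * q) (C c)
  C-modular c c<last = blocks-modular (residues-⊆ (splitAt n c))
      (A.sumFree (residueColor (splitAt n c))) side
    where
    side : Modular q (A (residueColor (splitAt n c))) ⊎ Modular p (blockNumbers (splitAt n c))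
    side with splitAt n c in eq
    ... | inj₁ i = inj₁ (lower-modular i)
    -- Here `c` has index `n + toℕ j`, so cancelling `n` in `c<last` shows that `j` is not the last
    -- color of `B`.
    ... | inj₂ j = inj₂ (B.modular j (+-cancelˡ-< n (suc (toℕ j)) k
            (subst (_< n + k)
              (trans (cong suc (trans (cong toℕ (sym (splitAt⁻¹-↑ʳ eq))) (toℕ-↑ʳ n j)))
                (sym (+-suc n (toℕ j))))
              c<last)))

  template : IsSTemplate (p * q) (n + k) C
  template = record
    { partition = partition
    ; sumFree   = λ c → color-sumFree (splitAt n c)
    ; modular   = C-modular
    }

theorem2p6 : (p k q n : ℕ) → 0 < p → 0 < k → 0 < q → 0 < n →
    (∃[ A ] IsSTemplate q (n + 1) A) →
    (∃[ B ] IsSTemplate p k B) →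
    ∃[ C ] IsSTemplate (p * q) (n + k) C
theorem2p6 p k q n _ _ 0<q _ (A , tA) (B , tB) = C , template
  where
  instance
    q≢0 : NonZero q
    q≢0 = >-nonZero 0<q
  open Product tA tB
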